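{- Let $\pi$ be a finite projective plane of order $n$, and let $S$ be a minimal $t$-fold blocking set in $\pi$. In case $n$ is a prime power $q$, the only possible values for $t$ for which equality can be reached in the upper bound $$|S| \le \frac{1}{2}n\sqrt{4tn-(3t+1)(t-1)}+\frac{1}{2}(t-1)n+t$$ are the following: (i) $t=1$ when $q$ is a square; in this case $S$ is a unital in $\pi$. (ii) $t=q-\sqrt{q}$ when $q$ is a square; in this case $S$ is the complement of a Baer subplane in $\pi$. (iii) $t=q$ for any $q$; in this case $S$ is the plane $\pi$ with one point removed.
   Context: A $t$-fold blocking set in a projective plane $\pi$ of order $n$ is a set $S$ of points of $\pi$ such that each line of $\pi$ intersects $S$ in at least $t$ points and some line of $\pi$ intersects $S$ in exactly $t$ points. It is called minimal if every point of $S$ is contained in a line intersecting $S$ in exactly $t$ points. Let $\pi$ be a projective plane of order $n$ with $n$ a square. A unital in $\pi$ is a set of $n\sqrt{n}+1$ points of $\pi$ such that each line of $\pi$ intersects it in $1$ or $\sqrt{n}+1$ points. A Baer subplane in $\pi$ is a set of $n+\sqrt{n}+1$ points of $\pi$ such that each line of $\pi$ intersects it in $1$ or $\sqrt{n}+1$ points. Background: the upper bound in the claim is a known theorem of Bishnoi, valid for every minimal $t$-fold blocking set $S$ in a finite projective plane of order $n$. That theorem also states that if the size of $S$ equals the bound, then every line of $\pi$ intersects $S$ in exactly $t$ or $b+1$ points, where $b=\frac{1}{2}\left(\sqrt{4tn-(3t+1)(t-1)}+t-1\right)$. The claim was conjectured by Bishnoi.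
   Formalization: The range 1 ≤ t ≤ q is assumed; without it the claim fails, since t = 0 with S empty and t = q+1 with S the whole plane are minimal t-fold blocking sets attaining the bound but are not in the list. -}

module Defs where

open import Data.Nat.Base as ℕ using (ℕ; suc)
open import Data.Nat.Primality using (Prime)
open import Data.Integer.Base using (+_)
open import Data.Rational.Base using (ℚ; 0ℚ; 1ℚ; ½; _≤_; _+_; _-_; _*_)
open import Data.Rational.Literals using (fromℤ)
open import Data.Fin.Base using (Fin)
open import Data.Fin.Subset using (Subset; _∈_; _∩_; ∣_∣)
open import Data.Product using (∃; ∃₂; ∃!; _×_)
open import Data.Sum.Base using (_⊎_)
open import Function.Definitions using (Injective)
open import Relation.Binary.PropositionalEquality using (_≡_; _≢_)
open import Relation.Nullary.Negation using (¬_)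

-- Points and lines are enumerated by finite initial segments of ℕ, and a line
-- is given by its set of points.  Distinct lines have distinct point sets: by
-- `meet`, two lines with the same point set would have a single point P, and
-- would then not meet a line avoiding P, which exists by `quadrangle`.
record ProjectivePlane : Set where
  field
    #points : ℕ
    #lines  : ℕ

  Point = Fin #points
  Line  = Fin #lines

  field
    line : Line → Subset #points
    join : ∀ {P Q : Point} → P ≢ Q → ∃! _≡_ λ ℓ → P ∈ line ℓ × Q ∈ line ℓ
    meet : ∀ {ℓ m : Line} → ℓ ≢ m → ∃! _≡_ λ P → P ∈ line ℓ × P ∈ line m
    quadrangle : ∃ λ (Q : Fin 4 → Point) →
      Injective _≡_ _≡_ Q ×
      (∀ {i j k} → i ≢ j → j ≢ k → i ≢ k →
        ∀ ℓ → ¬ (Q i ∈ line ℓ × Q j ∈ line ℓ × Q k ∈ line ℓ))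

module _ (π : ProjectivePlane) where
  open ProjectivePlane π

  HasOrder : ℕ → Set
  HasOrder n = ∀ ℓ → ∣ line ℓ ∣ ≡ suc n

  IsBlockingSet : ℕ → Subset #points → Set
  IsBlockingSet t S =
    (∀ ℓ → t ℕ.≤ ∣ S ∩ line ℓ ∣) ×
    (∃ λ ℓ → ∣ S ∩ line ℓ ∣ ≡ t)

  IsMinimalBlockingSet : ℕ → Subset #points → Set
  IsMinimalBlockingSet t S =
    IsBlockingSet t S ×
    (∀ P → P ∈ S → ∃ λ ℓ → P ∈ line ℓ × ∣ S ∩ line ℓ ∣ ≡ t)

  -- In the next two definitions n is the order of π and s = √n.
  IsUnital : (n s : ℕ) → Subset #points → Set
  IsUnital n s U =
    ∣ U ∣ ≡ n ℕ.* s ℕ.+ 1 ×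
    (∀ ℓ → ∣ U ∩ line ℓ ∣ ≡ 1 ⊎ ∣ U ∩ line ℓ ∣ ≡ s ℕ.+ 1)

  IsBaerSubplane : (n s : ℕ) → Subset #points → Set
  IsBaerSubplane n s B =
    ∣ B ∣ ≡ n ℕ.+ s ℕ.+ 1 ×
    (∀ ℓ → ∣ B ∩ line ℓ ∣ ≡ 1 ⊎ ∣ B ∩ line ℓ ∣ ≡ s ℕ.+ 1)

IsPrimePower : ℕ → Set
IsPrimePower q = ∃₂ λ p k → Prime p × 1 ℕ.≤ k × q ≡ p ℕ.^ k

fromℕ : ℕ → ℚ
fromℕ m = fromℤ (+ m)

_IsSquareRootOf_ : ℚ → ℚ → Set
r IsSquareRootOf x = 0ℚ ≤ r × r * r ≡ x

-- m = ½ n √(4tn − (3t+1)(t−1)) + ½ (t−1) n + t.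
-- The real square root may be sought in ℚ: if the equation holds with n ≠ 0,
-- then the root equals (2m − (t−1)n − 2t) / n and is therefore rational.
AttainsBound : (n t m : ℕ) → Set
AttainsBound n t m = ∃ λ r →
  r IsSquareRootOf
    (fromℕ 4 * t′ * n′ - (fromℕ 3 * t′ + 1ℚ) * (t′ - 1ℚ)) ×
  fromℕ m ≡ ½ * n′ * r + ½ * (t′ - 1ℚ) * n′ + t′
  where
  n′ t′ : ℚ
  n′ = fromℕ n
  t′ = fromℕ t

{-# OPTIONS --safe #-}

-- Put m = |S| and x(ℓ) = |S ∩ ℓ|, and let T(P) be the number of t-secants through a point P.
-- Squaring the equality in the bound gives a quadratic equation for m, which implies
--
--   t Σ_{x(ℓ) ≠ t} (n x(ℓ) − C)² + (n t − C)² Σ_{P ∈ S} (T(P) − 1) = 0,   C = m − t + n,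
--
-- by the standard counts of Σ x(ℓ) and Σ x(ℓ)².  By minimality both terms are nonnegative, and
-- n t ≠ C, so every point of S is on exactly one t-secant and all other lines meet S in the
-- same number d + t of points.  Counting along the lines through a point outside S gives d ∣ n, and the
-- quadratic equation becomes d (d − 1) = t (n + 1 − d − t).  Hence d divides t (t − 1), and, n
-- being a prime power, d divides t or t − 1; only (d², t) = (n, 1), (n, n − d) and
-- (d, t) = (1, n) remain.

module Submission where

open import Defs
open import Data.Product using (∃; _×_; _,_; proj₁; proj₂)
open import Data.Sum using (_⊎_; inj₁; inj₂; [_,_]′; map; swap)
open import Function using (_∘_; id; case_of_)
open import Relation.Binary.PropositionalEquality
open import Relation.Nullary using (¬_; yes; no; does; contradiction)

-- Arithmetic of the parameters

module Parameters where
  open import Data.Nat.Base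
  open import Data.Nat.Coprimality as Coprime using (Coprime; coprime-divisor)
  open import Data.Nat.Divisibility
  open import Data.Nat.Primality using (Prime; prime⇒irreducible; prime⇒nonTrivial)
  open import Data.Nat.Properties
  open import Data.Nat.Tactic.RingSolver using (solve-∀)

  ∤⇒coprime : ∀ {p m} → Prime p → ¬ p ∣ m → Coprime p m
  ∤⇒coprime prime-p p∤m (c∣p , c∣m) with prime⇒irreducible prime-p c∣p
  ... | inj₁ c≡1  = c≡1
  ... | inj₂ refl = contradiction c∣m p∤m

  coprime-* : ∀ {a b m} → Coprime a m → Coprime b m → Coprime (a * b) m
  coprime-* {a} a⊥m b⊥m {c} (c∣ab , c∣m) = b⊥m (coprime-divisor c⊥a c∣ab , c∣m)
    where
    c⊥a : Coprime c a
    c⊥a (e∣c , e∣a) = a⊥m (e∣a , ∣-trans e∣c c∣m)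

  coprime-^ : ∀ {a m} k → Coprime a m → Coprime (a ^ k) m
  coprime-^ {m = m} zero _ = Coprime.1-coprimeTo m
  coprime-^ (suc k) a⊥m    = coprime-* a⊥m (coprime-^ k a⊥m)

  ∣prime-power⇒coprime : ∀ {p d j} k → Prime p → d ∣ p ^ k → ¬ p ∣ j → Coprime d j
  ∣prime-power⇒coprime k prime-p d∣p^k p∤j (c∣d , c∣j) =
    coprime-^ k (∤⇒coprime prime-p p∤j) (∣-trans c∣d d∣p^k , c∣j)

  -- The prime-power hypothesis enters here: p cannot divide both m and m + 1, so d, a divisor of a
  -- power of p, is coprime to one factor and divides the other.
  ∣m[1+m]⇒∣m⊎∣1+m : ∀ {q d m} → IsPrimePower q → d ∣ q → d ∣ m * suc m → d ∣ m ⊎ d ∣ suc m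
  ∣m[1+m]⇒∣m⊎∣1+m {d = d} {m} (p , k , prime-p , _ , refl) d∣q d∣m[1+m] with p ∣? m
  ... | no  p∤m = inj₂ (coprime-divisor (∣prime-power⇒coprime k prime-p d∣q p∤m) d∣m[1+m])
  ... | yes p∣m = inj₁ (coprime-divisor (∣prime-power⇒coprime k prime-p d∣q p∤1+m)
                          (subst (d ∣_) (*-comm m (suc m)) d∣m[1+m]))
    where
    p∤1+m : ¬ p ∣ suc m
    p∤1+m p∣1+m = nonTrivial⇒≢1 {{prime⇒nonTrivial prime-p}}
      (∣1⇒≡1 (∣m+n∣m⇒∣n (subst (p ∣_) (+-comm 1 m) p∣1+m) p∣m))

  -- The solutions of d (d − 1) = t (q + 1 − d − t) with d a divisor of the prime power q.
  Solution : (q d t : ℕ) → Set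
  Solution q d t = (d * d ≡ q × t ≡ 1) ⊎ (d * d ≡ q × d + t ≡ q) ⊎ (d ≡ 1 × t ≡ q)

  -- With d = e + 1 and t = u d, division by d leaves e + u (e + u d) = u q, so e = w u for some w,
  -- and q = u d + (w + e). Then d divides w + e, which is at most 2 e < 2 d. Quotient 0 gives d = 1
  -- and t = q; quotient 1 gives w = 1, e = u, and hence d² = d + t = q.
  solution-∣t : ∀ q d t .{{_ : NonZero d}} .{{_ : NonZero t}} → d ∣ q → d ∣ t →
    d * d + t * (d + t) ≡ d + t * suc q → Solution q d t
  solution-∣t q d@(suc e) t d∣q (divides zero t≡0) eq = contradiction t≡0 (≢-nonZero⁻¹ t)
  solution-∣t q d@(suc e) _ d∣q (divides u@(suc _) refl) eq = by-quotient u∣e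
    where
    e+u[e+ud]≡uq : e + u * (e + u * d) ≡ u * q
    e+u[e+ud]≡uq = *-cancelˡ-≡ _ _ d (+-cancelˡ-≡ (d + u * d) _ _
      (trans (lhs e u) (trans eq (rhs e u q))))
      where
      lhs : ∀ e u → suc e + u * suc e + suc e * (e + u * (e + u * suc e)) ≡
                    suc e * suc e + u * suc e * (suc e + u * suc e)
      lhs = solve-∀
      rhs : ∀ e u q → suc e + u * suc e * suc q ≡ suc e + u * suc e + suc e * (u * q)
      rhs = solve-∀
    u∣e : u ∣ e
    u∣e = ∣m+n∣m⇒∣n
      (subst (u ∣_) (trans (sym e+u[e+ud]≡uq) (+-comm e _)) (m∣m*n q))
      (m∣m*n (e + u * d))
    by-sum : ∀ w → e ≡ w * u → w ≤ e → q ≡ u * d + (w + e) → d ∣ w + e → Solution q d (u * d)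
    by-sum w e≡wu w≤e q≡ (divides zero w+e≡0) = inj₂ (inj₂
      ( cong suc (m+n≡0⇒n≡0 w w+e≡0)
      , sym (trans q≡ (trans (cong (u * d +_) w+e≡0) (+-identityʳ _)))))
    by-sum w e≡wu w≤e q≡ (divides 1 w+e≡d) = inj₂ (inj₁
      ( trans (square e) (trans (cong (λ i → i * d + d) e≡u) q≡ud+d)
      , trans (+-comm d _) q≡ud+d))
      where
      q≡ud+d : u * d + d ≡ q
      q≡ud+d = sym (trans q≡ (cong (u * d +_) (trans w+e≡d (*-identityˡ d))))
      w≡1 : w ≡ 1
      w≡1 = +-cancelʳ-≡ e w 1 (trans w+e≡d (*-identityˡ d))
      e≡u : e ≡ u
      e≡u = trans e≡wu (trans (cong (_* u) w≡1) (*-identityˡ u))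
      square : ∀ e → suc e * suc e ≡ e * suc e + suc e
      square = solve-∀
    by-sum w e≡wu w≤e q≡ (divides (suc (suc y)) w+e≡) = contradiction w+e≡ (<⇒≢ (begin-strict
      w + e               ≤⟨ +-monoˡ-≤ e w≤e ⟩
      e + e               <⟨ +-mono-< (n<1+n e) (n<1+n e) ⟩
      d + d               ≤⟨ +-monoʳ-≤ d (m≤m+n d (y * d)) ⟩
      d + (d + y * d)     ∎))
      where open ≤-Reasoning
    by-quotient : u ∣ e → Solution q d (u * d)
    by-quotient (divides w e≡wu) = by-sum w e≡wu (subst (w ≤_) (sym e≡wu) (m≤m*n w u)) q≡
      (∣m+n∣m⇒∣n (subst (d ∣_) q≡ d∣q) (n∣m*n u))
      where
      expand : ∀ e u w → u * (u * suc e + (w + e)) ≡ w * u + u * (e + u * suc e)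
      expand = solve-∀
      q≡ : q ≡ u * d + (w + e)
      q≡ = sym (*-cancelˡ-≡ _ _ u
        (trans (expand e u w) (trans (cong (_+ u * (e + u * d)) (sym e≡wu)) e+u[e+ud]≡uq)))

  -- The parameter is now T = u d + 1. With d = e + 1 and q = v d, division by d leaves e + T (1 +
  -- u) = T v, so T divides e. If u > 0, then T > e, which forces e = 0, that is, d = 1 and T = q.
  -- If u = 0, then T = 1 and v = d, so d² = q.
  solution-∣t∸1 : ∀ q d t .{{_ : NonZero d}} → d ∣ q → d ∣ t →
    d * d + suc t * (d + suc t) ≡ d + suc t * suc q → Solution q d (suc t)
  solution-∣t∸1 _ d@(suc e) _ (divides v refl) (divides u refl) eq = by-size e refl u refl
    where
    t : ℕ
    t = suc (u * d)
    e+t[1+u]≡tv : e + t * suc u ≡ t * v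
    e+t[1+u]≡tv = *-cancelˡ-≡ _ _ d (+-cancelˡ-≡ (d + t) _ _
      (trans (lhs e u) (trans eq (rhs e u v))))
      where
      lhs : ∀ e u → suc e + suc (u * suc e) + suc e * (e + suc (u * suc e) * suc u) ≡
                    suc e * suc e + suc (u * suc e) * (suc e + suc (u * suc e))
      lhs = solve-∀
      rhs : ∀ e u v → suc e + suc (u * suc e) * suc (v * suc e) ≡
                      suc e + suc (u * suc e) + suc e * (suc (u * suc e) * v)
      rhs = solve-∀
    t∣e : t ∣ e
    t∣e = ∣m+n∣m⇒∣n (subst (t ∣_) (trans (sym e+t[1+u]≡tv) (+-comm e _)) (m∣m*n v)) (m∣m*n (suc u))
    by-size : ∀ e′ → e′ ≡ e → ∀ u′ → u′ ≡ u → Solution (v * d) d t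
    by-size zero refl _ _ = inj₂ (inj₂ (refl , trans (cong suc (*-identityʳ u))
      (trans (*-cancelˡ-≡ _ _ t e+t[1+u]≡tv) (sym (*-identityʳ v)))))
    by-size (suc _) refl zero refl = inj₁
      (cong (_* d) (trans (trans (sym (*-identityʳ d)) (square e)) (trans e+t[1+u]≡tv (*-identityˡ v))) , refl)
      where
      square : ∀ e → suc e * 1 ≡ e + 1 * 1
      square = solve-∀
    by-size (suc _) refl (suc u′) refl =
      contradiction (∣⇒≤ t∣e) (<⇒≱ (≤-trans (n<1+n e) (≤-trans (m≤m+n d (u′ * d)) (n≤1+n _))))

  -- For the parameter t + 1 the equation reads d (d + t) + t (t + 1) = (t + 1) q. Since d divides
  -- q, it divides t (t + 1), and therefore one of the two factors.
  solution : ∀ {q} d t .{{_ : NonZero d}} .{{_ : NonZero t}} → IsPrimePower q → d ∣ q →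
    d * d + t * (d + t) ≡ d + t * suc q → Solution q d t
  solution {q} d (suc t) qpp d∣q eq =
    [ (λ d∣t   → solution-∣t∸1 q d t d∣q d∣t eq)
    , (λ d∣1+t → solution-∣t q d (suc t) d∣q d∣1+t eq)
    ]′
      (∣m[1+m]⇒∣m⊎∣1+m qpp d∣q d∣t[1+t])
    where
    d[d+t]+t[1+t]≡[1+t]q : d * (d + t) + t * suc t ≡ suc t * q
    d[d+t]+t[1+t]≡[1+t]q = +-cancelʳ-≡ (d + suc t) _ _ (trans (lhs d t) (trans eq (rhs d t q)))
      where
      lhs : ∀ d t → d * (d + t) + t * suc t + (d + suc t) ≡ d * d + suc t * (d + suc t)
      lhs = solve-∀
      rhs : ∀ d t q → d + suc t * suc q ≡ suc t * q + (d + suc t)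
      rhs = solve-∀
    d∣t[1+t] : d ∣ t * suc t
    d∣t[1+t] = ∣m+n∣m⇒∣n
      (subst (d ∣_) (sym d[d+t]+t[1+t]≡[1+t]q) (∣n⇒∣m*n (suc t) d∣q)) (m∣m*n (d + t))

-- The bound as a quadratic equation

module Bound where
  open import Algebra.Properties.Group using (∙-cancelʳ)
  open import Data.Integer.Base as ℤ using (+_)
  import Data.Integer.Properties as ℤ
  open import Data.Nat.Base as ℕ using (ℕ)
  open import Data.Rational.Base using (ℚ; ½; 1ℚ; _+_; _*_; _-_; _/_; ↥_)
  open import Data.Rational.Literals using (fromℤ)
  import Data.Rational.Properties as ℚ
  open import Data.Rational.Solver using (module +-*-Solver)

  -- Sums and products of rationals are defined through the normalising quotient `_/_`; this brings
  -- literals into the same form.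
  fromℤ≡/1 : ∀ i → fromℤ i ≡ i / 1
  fromℤ≡/1 i = sym (ℚ.↥p/↧p≡p (fromℤ i))

  fromℕ-+ : ∀ {a b x y} → fromℕ a ≡ x → fromℕ b ≡ y → fromℕ (a ℕ.+ b) ≡ x + y
  fromℕ-+ {a} {b} refl refl = trans (fromℤ≡/1 (+ (a ℕ.+ b)))
    (cong₂ (λ i j → (i ℤ.+ j) / 1) (sym (ℤ.*-identityʳ (+ a))) (sym (ℤ.*-identityʳ (+ b))))

  fromℕ-* : ∀ {a b x y} → fromℕ a ≡ x → fromℕ b ≡ y → fromℕ (a ℕ.* b) ≡ x * y
  fromℕ-* {a} {b} refl refl = trans (fromℤ≡/1 (+ (a ℕ.* b))) (cong (_/ 1) (ℤ.pos-* a b))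

  fromℕ-injective : ∀ {a b} → fromℕ a ≡ fromℕ b → a ≡ b
  fromℕ-injective eq = ℤ.+-injective (cong ↥_ eq)

  -- Isolating the root in the bound gives m - t - (t - 1) n / 2 = n r / 2. Squaring and replacing
  -- r² by the radicand removes all fractions; negative terms are moved across to stay within ℕ.
  bound⇒quadratic : ∀ n t m → AttainsBound n t m →
    m ℕ.* m ℕ.+ m ℕ.* n ℕ.+ t ℕ.* t ℕ.* (n ℕ.* n ℕ.+ n ℕ.+ 1) ≡
    m ℕ.* (t ℕ.* n ℕ.+ 2 ℕ.* t) ℕ.+ t ℕ.* n ℕ.* (n ℕ.* n ℕ.+ n ℕ.+ 1)
  bound⇒quadratic n t m (r , (_ , r²≡D) , m≡) = fromℕ-injective (trans
    (fromℕ-+ (fromℕ-+ (fromℕ-* m≡ m≡) (fromℕ-* m≡ refl)) (fromℕ-* (fromℕ-* {t} {t} refl refl) L≡))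
    (trans ℚ-identity (sym
    (fromℕ-+ (fromℕ-* m≡ (fromℕ-+ (fromℕ-* {t} {n} refl refl) (fromℕ-* {2} {t} refl refl)))
       (fromℕ-* (fromℕ-* {t} {n} refl refl) L≡)))))
    where
    L≡ : fromℕ (n ℕ.* n ℕ.+ n ℕ.+ 1) ≡ fromℕ n * fromℕ n + fromℕ n + 1ℚ
    L≡ = fromℕ-+ (fromℕ-+ {n ℕ.* n} {n} (fromℕ-* {n} {n} refl refl) refl) refl
    n′ t′ D : ℚ
    n′ = fromℕ n
    t′ = fromℕ t
    D = fromℕ 4 * t′ * n′ - (fromℕ 3 * t′ + 1ℚ) * (t′ - 1ℚ)
    M : ℚ
    M = ½ * n′ * r + ½ * (t′ - 1ℚ) * n′ + t′
    ℚ-identity : M * M + M * n′ + t′ * t′ * (n′ * n′ + n′ + 1ℚ) ≡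
                 M * (t′ * n′ + fromℕ 2 * t′) + t′ * n′ * (n′ * n′ + n′ + 1ℚ)
    -- With n² D / 4 added on both sides, replacing D by r² on the right leaves a polynomial
    -- identity in r, n and t.
    ℚ-identity = ∙-cancelʳ ℚ.+-0-group (½ * ½ * n′ * n′ * D) _ _
      (trans
        (solve 3 (λ r n t →
           let M = con ½ :* n :* r :+ con ½ :* (t :- con 1ℚ) :* n :+ t
               D = con (fromℕ 4) :* t :* n :- (con (fromℕ 3) :* t :+ con 1ℚ) :* (t :- con 1ℚ)
           in M :* M :+ M :* n :+ t :* t :* (n :* n :+ n :+ con 1ℚ) :+ con ½ :* con ½ :* n :* n :* D
           := M :* (t :* n :+ con (fromℕ 2) :* t) :+ t :* n :* (n :* n :+ n :+ con 1ℚ)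
                :+ con ½ :* con ½ :* n :* n :* (r :* r))
          refl r n′ t′)
        (cong (λ D → M * (t′ * n′ + fromℕ 2 * t′) + t′ * n′ * (n′ * n′ + n′ + 1ℚ) + ½ * ½ * n′ * n′ * D) r²≡D))
      where open +-*-Solver

module Counting where
  import Algebra.Properties.AbelianGroup as AbelianGroupProperties
  open import Data.Bool.Base using (Bool; true; false; _∧_)
  open import Data.Fin.Base using (Fin; zero; suc)
  open import Data.Fin.Patterns using (0F; 1F; 2F)
  import Data.Fin.Properties as Fin
  open import Data.Fin.Subset as Subset using (Subset; inside; outside; _∈_; _∉_; _∩_; ∁; ⊤; ∣_∣)
  open import Data.Fin.Subset.Properties
    using (_∈?_; nonempty?; Empty-unique; ∣⊥∣≡0; ∣p∣≤n; ∣p∣≡n⇒p≡⊤; ∣∁p∣≡n∸∣p∣; p─⊥≡p;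
           p⊆q⇒∣p∣≤∣q∣; p∩q⊆p; x∈p∩q⁺)
  open import Data.Integer.Base as ℤ using (ℤ; +_; -[1+_]; 0ℤ; 1ℤ; +≤+; _≤_; _+_; _*_; _-_; -_)
  open import Data.Integer.Properties hiding (_≟_)
  open import Data.Integer.Tactic.RingSolver using (solve-∀)
  open import Data.Nat.Base as ℕ using (ℕ; zero; suc; NonZero)
  import Data.Nat.Divisibility as ℕ
  import Data.Nat.Properties as ℕ
  import Data.Nat.Tactic.RingSolver as ℕ-Solver
  open import Data.Vec.Base using ([]; _∷_; lookup)
  open import Data.Vec.Properties using (lookup-zipWith; []=⇒lookup; lookup⇒[]=)
  open import Relation.Nullary.Decidable using (dec-true; dec-false)
  open import Algebra.Properties.Semiring.Sum +-*-semiring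
    using (sum; sum-syntax; sum-cong-≗; sum-remove; sum-replicate-zero; ∑-comm; ∑-distrib-+;
           *-distribˡ-sum; *-distribʳ-sum)
  open Bound using (bound⇒quadratic)
  open Parameters using (Solution)

  -- Sums of integers and sizes of subsets

  sum-zero : ∀ {k} {f : Fin k → ℤ} → (∀ i → f i ≡ 0ℤ) → sum f ≡ 0ℤ
  sum-zero {k} f≡0 = trans (sum-cong-≗ f≡0) (sum-replicate-zero k)

  sum-single : ∀ {k} (f : Fin k → ℤ) i → (∀ j → i ≢ j → f j ≡ 0ℤ) → sum f ≡ f i
  sum-single {suc k} f i f≡0 = trans (sum-remove {i = i} f) (trans
    (cong (_+_ (f i)) (sum-zero λ j → f≡0 _ (Fin.punchInᵢ≢i i j ∘ sym)))
    (+-identityʳ (f i)))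

  sum-nonNeg : ∀ {k} {f : Fin k → ℤ} → (∀ i → 0ℤ ≤ f i) → 0ℤ ≤ sum f
  sum-nonNeg {zero}  f≥0 = ≤-refl
  sum-nonNeg {suc k} f≥0 = +-mono-≤ (f≥0 zero) (sum-nonNeg (f≥0 ∘ suc))

  +-nonNeg-≡0 : ∀ {i j} → 0ℤ ≤ i → 0ℤ ≤ j → i + j ≡ 0ℤ → i ≡ 0ℤ × j ≡ 0ℤ
  +-nonNeg-≡0 {+ a} {+ b} _ _ eq =
    cong +_ (ℕ.m+n≡0⇒m≡0 a (+-injective eq)) , cong +_ (ℕ.m+n≡0⇒n≡0 a (+-injective eq))

  sum-nonNeg-≡0 : ∀ {k} {f : Fin k → ℤ} → (∀ i → 0ℤ ≤ f i) → sum f ≡ 0ℤ → ∀ i → f i ≡ 0ℤ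
  sum-nonNeg-≡0 f≥0 eq zero    = proj₁ (+-nonNeg-≡0 (f≥0 zero) (sum-nonNeg (f≥0 ∘ suc)) eq)
  sum-nonNeg-≡0 f≥0 eq (suc i) = sum-nonNeg-≡0 (f≥0 ∘ suc)
    (proj₂ (+-nonNeg-≡0 (f≥0 zero) (sum-nonNeg (f≥0 ∘ suc)) eq)) i

  term≤sum : ∀ {k} {f : Fin k → ℤ} → (∀ i → 0ℤ ≤ f i) → ∀ i → f i ≤ sum f
  term≤sum {f = f} f≥0 zero    = ≤-trans (≤-reflexive (sym (+-identityʳ (f zero))))
    (+-monoʳ-≤ (f zero) (sum-nonNeg (f≥0 ∘ suc)))
  term≤sum {f = f} f≥0 (suc i) = ≤-trans (term≤sum (f≥0 ∘ suc) i)
    (≤-trans (≤-reflexive (sym (+-identityˡ _))) (+-monoˡ-≤ (sum (f ∘ suc)) (f≥0 zero)))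

  sum-1 : ∀ k → ∑[ i < k ] 1ℤ ≡ + k
  sum-1 zero    = refl
  sum-1 (suc k) = cong (_+_ 1ℤ) (sum-1 k)

  -- The shape of most double counts below: a and b weight the two index sets and c is the incidence
  -- matrix between them.
  ∑-assoc-comm : ∀ {k l} (a : Fin k → ℤ) (b : Fin l → ℤ) (c : Fin l → Fin k → ℤ) →
    ∑[ i < k ] (a i * ∑[ j < l ] (b j * c j i)) ≡ ∑[ j < l ] (b j * ∑[ i < k ] (a i * c j i))
  ∑-assoc-comm {k} {l} a b c = begin
    ∑[ i < k ] (a i * ∑[ j < l ] (b j * c j i))
      ≡⟨ sum-cong-≗ (λ i → *-distribˡ-sum (a i) (λ j → b j * c j i)) ⟩
    ∑[ i < k ] ∑[ j < l ] (a i * (b j * c j i))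
      ≡⟨ ∑-comm (λ i j → a i * (b j * c j i)) ⟩
    ∑[ j < l ] ∑[ i < k ] (a i * (b j * c j i))
      ≡⟨ sum-cong-≗ (λ j → sum-cong-≗ λ i → swap-* (a i) (b j) (c j i)) ⟩
    ∑[ j < l ] ∑[ i < k ] (b j * (a i * c j i))
      ≡⟨ sum-cong-≗ (λ j → *-distribˡ-sum (b j) (λ i → a i * c j i)) ⟨
    ∑[ j < l ] (b j * ∑[ i < k ] (a i * c j i))   ∎
    where
    open ≡-Reasoning
    swap-* : ∀ x y z → x * (y * z) ≡ y * (x * z)
    swap-* = solve-∀

  ∑-linear : ∀ {k} (a b : ℤ) (f g : Fin k → ℤ) →
    ∑[ i < k ] (a * f i + b * g i) ≡ a * sum f + b * sum g
  ∑-linear a b f g = trans (∑-distrib-+ (λ i → a * f i) (λ i → b * g i))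
    (sym (cong₂ _+_ (*-distribˡ-sum a f) (*-distribˡ-sum b g)))

  𝟙 : Bool → ℤ
  𝟙 false = 0ℤ
  𝟙 true  = 1ℤ

  𝟙-nonNeg : ∀ b → 0ℤ ≤ 𝟙 b
  𝟙-nonNeg false = ≤-refl
  𝟙-nonNeg true  = +≤+ ℕ.z≤n

  𝟙-idem : ∀ b → 𝟙 b * 𝟙 b ≡ 𝟙 b
  𝟙-idem false = refl
  𝟙-idem true  = refl

  𝟙-∧ : ∀ b c → 𝟙 (b ∧ c) ≡ 𝟙 b * 𝟙 c
  𝟙-∧ false c     = refl
  𝟙-∧ true  false = refl
  𝟙-∧ true  true  = refl

  𝟙*𝟙≡0 : ∀ b c → ¬ (b ≡ true × c ≡ true) → 𝟙 b * 𝟙 c ≡ 0ℤ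
  𝟙*𝟙≡0 false c     _   = refl
  𝟙*𝟙≡0 true  false _   = refl
  𝟙*𝟙≡0 true  true  ¬bc = contradiction (refl , refl) ¬bc

  χ : ∀ {k} → Subset k → Fin k → ℤ
  χ p i = 𝟙 (lookup p i)

  χ-∈ : ∀ {k} {p : Subset k} {i} → i ∈ p → χ p i ≡ 1ℤ
  χ-∈ i∈p = cong 𝟙 ([]=⇒lookup i∈p)

  χ-∉ : ∀ {k} {p : Subset k} {i} → i ∉ p → χ p i ≡ 0ℤ
  χ-∉ {p = p} {i} i∉p with lookup p i in eq
  ... | false = refl
  ... | true  = contradiction (lookup⇒[]= i p eq) i∉p

  χ-∩ : ∀ {k} (p q : Subset k) i → χ (p ∩ q) i ≡ χ p i * χ q i
  χ-∩ p q i = trans (cong 𝟙 (lookup-zipWith _∧_ i p q)) (𝟙-∧ (lookup p i) (lookup q i))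

  sum-χ : ∀ {k} (p : Subset k) → sum (χ p) ≡ + ∣ p ∣
  sum-χ []            = refl
  sum-χ (inside  ∷ p) = cong (_+_ 1ℤ) (sum-χ p)
  sum-χ (outside ∷ p) = trans (+-identityˡ _) (sum-χ p)

  *-≡0ʳ : ∀ i {j} → i ≢ 0ℤ → i * j ≡ 0ℤ → j ≡ 0ℤ
  *-≡0ʳ i i≢0 ij≡0 = [ (λ i≡0 → contradiction i≡0 i≢0) , id ]′ (i*j≡0⇒i≡0∨j≡0 i ij≡0)

  *-self-nonNeg : ∀ i → 0ℤ ≤ i * i
  *-self-nonNeg (+ k)    = subst (0ℤ ≤_) (pos-* k k) (+≤+ ℕ.z≤n)
  *-self-nonNeg -[1+ k ] = +≤+ ℕ.z≤n

  *-nonNeg : ∀ {i j} → 0ℤ ≤ i → 0ℤ ≤ j → 0ℤ ≤ i * j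
  *-nonNeg {+ a} {+ b} _ _ = subst (0ℤ ≤_) (pos-* a b) (+≤+ ℕ.z≤n)

  ∣∁p∩q∣+∣p∩q∣≡∣q∣ : ∀ {k} (p q : Subset k) → ∣ ∁ p ∩ q ∣ ℕ.+ ∣ p ∩ q ∣ ≡ ∣ q ∣
  ∣∁p∩q∣+∣p∩q∣≡∣q∣ []            []            = refl
  ∣∁p∩q∣+∣p∩q∣≡∣q∣ (inside  ∷ p) (inside  ∷ q) = trans (ℕ.+-suc _ _) (cong suc (∣∁p∩q∣+∣p∩q∣≡∣q∣ p q))
  ∣∁p∩q∣+∣p∩q∣≡∣q∣ (outside ∷ p) (inside  ∷ q) = cong suc (∣∁p∩q∣+∣p∩q∣≡∣q∣ p q)
  ∣∁p∩q∣+∣p∩q∣≡∣q∣ (inside  ∷ p) (outside ∷ q) = ∣∁p∩q∣+∣p∩q∣≡∣q∣ p q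
  ∣∁p∩q∣+∣p∩q∣≡∣q∣ (outside ∷ p) (outside ∷ q) = ∣∁p∩q∣+∣p∩q∣≡∣q∣ p q

  -- The first `outside` entry is the missing element: the tail behind it has full size and hence
  -- equals `⊤`.
  1+∣p∣≡n⇒p≡⊤-x : ∀ {k} (p : Subset k) → suc ∣ p ∣ ≡ k → ∃ λ x → p ≡ ⊤ Subset.- x
  1+∣p∣≡n⇒p≡⊤-x (inside  ∷ p) eq with x , p≡ ← 1+∣p∣≡n⇒p≡⊤-x p (ℕ.suc-injective eq) =
    suc x , cong (inside ∷_) p≡
  1+∣p∣≡n⇒p≡⊤-x (outside ∷ p) eq =
    zero , cong (outside ∷_) (trans (∣p∣≡n⇒p≡⊤ (ℕ.suc-injective eq)) (sym (p─⊥≡p ⊤)))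

  -- Incidences in a projective plane

  module Incidence (π : ProjectivePlane) where
    open ProjectivePlane π

    I : Point → Line → ℤ
    I P ℓ = χ (line ℓ) P

    ∑-lines-through : ∀ {P Q} → P ≢ Q → ∑[ ℓ < #lines ] (I P ℓ * I Q ℓ) ≡ 1ℤ
    ∑-lines-through {P} {Q} P≢Q with ℓ , (P∈ℓ , Q∈ℓ) , unique ← join P≢Q =
      trans (sum-single _ ℓ λ m ℓ≢m →
              𝟙*𝟙≡0 (lookup (line m) P) (lookup (line m) Q) λ (P∈m , Q∈m) →
              ℓ≢m (unique (lookup⇒[]= P (line m) P∈m , lookup⇒[]= Q (line m) Q∈m)))
            (cong₂ _*_ (χ-∈ P∈ℓ) (χ-∈ Q∈ℓ))

    ∑-common-points : ∀ {ℓ m} → ℓ ≢ m → ∑[ P < #points ] (I P ℓ * I P m) ≡ 1ℤ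
    ∑-common-points {ℓ} {m} ℓ≢m with P , (P∈ℓ , P∈m) , unique ← meet ℓ≢m =
      trans (sum-single _ P λ Q P≢Q →
              𝟙*𝟙≡0 (lookup (line ℓ) Q) (lookup (line m) Q) λ (Q∈ℓ , Q∈m) →
              P≢Q (unique (lookup⇒[]= Q (line ℓ) Q∈ℓ , lookup⇒[]= Q (line m) Q∈m)))
            (cong₂ _*_ (χ-∈ P∈ℓ) (χ-∈ P∈m))

    -- One side of the triangle Q₀Q₁Q₂ misses P. If all three passed through P, then either P = Q₀
    -- lies on Q₁Q₂, or the sides Q₀Q₁ and Q₀Q₂ share the points P ≠ Q₀ and coincide; both make the
    -- triangle collinear.
    avoiding-line : ∀ P → ∃ λ ℓ → P ∉ line ℓ
    avoiding-line P with quadrangle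
    ... | Q , Q-inj , general
      with join (λ eq → case Q-inj {0F} {1F} eq of λ ())
         | join (λ eq → case Q-inj {0F} {2F} eq of λ ())
         | join (λ eq → case Q-inj {1F} {2F} eq of λ ())
    ... | a , (Q₀∈a , Q₁∈a) , _ | b , (Q₀∈b , Q₂∈b) , _ | c , (Q₁∈c , Q₂∈c) , _
      with P ∈? line a | P ∈? line b | P ∈? line c
    ... | no P∉a  | _       | _       = a , P∉a
    ... | yes _   | no P∉b  | _       = b , P∉b
    ... | yes _   | yes _   | no P∉c  = c , P∉c
    ... | yes P∈a | yes P∈b | yes P∈c with P Fin.≟ Q 0F
    ...   | yes refl = contradiction (P∈c , Q₁∈c , Q₂∈c) (general (λ ()) (λ ()) (λ ()) c)
    ...   | no  P≢Q₀ = contradiction (Q₀∈a , Q₁∈a , subst (λ ℓ → Q 2F ∈ line ℓ) b≡a Q₂∈b)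
                                     (general (λ ()) (λ ()) (λ ()) a)
      where
      b≡a : b ≡ a
      b≡a with _ , _ , unique ← join P≢Q₀ = trans (sym (unique (P∈b , Q₀∈b))) (unique (P∈a , Q₀∈a))

    -- Counting in a plane of order n

    module Order (n : ℕ) (order : HasOrder π n) where

      ∑-points-on : ∀ ℓ → ∑[ P < #points ] I P ℓ ≡ + suc n
      ∑-points-on ℓ = trans (sum-χ (line ℓ)) (cong +_ (order ℓ))

      -- Projection from P onto a line ℓ not through P.
      ∑-pencil : ∀ P → ∑[ ℓ < #lines ] I P ℓ ≡ + suc n
      ∑-pencil P with ℓ , P∉ℓ ← avoiding-line P = begin
        ∑[ m < #lines ] I P m                                              ≡⟨ sum-cong-≗ meets-ℓ ⟩
        ∑[ m < #lines ] (I P m * ∑[ Q < #points ] (I Q ℓ * I Q m))         ≡⟨ ∑-assoc-comm (I P) (λ Q → I Q ℓ) I ⟩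
        ∑[ Q < #points ] (I Q ℓ * ∑[ m < #lines ] (I P m * I Q m))         ≡⟨ sum-cong-≗ joined-to-P ⟩
        ∑[ Q < #points ] I Q ℓ                                             ≡⟨ ∑-points-on ℓ ⟩
        + suc n                                                            ∎
        where
        open ≡-Reasoning
        meets-ℓ : ∀ m → I P m ≡ I P m * ∑[ Q < #points ] (I Q ℓ * I Q m)
        meets-ℓ m with P ∈? line m
        ... | yes P∈m = sym (trans (cong (I P m *_) (∑-common-points λ { refl → P∉ℓ P∈m })) (*-identityʳ _))
        ... | no  P∉m = trans (χ-∉ P∉m) (sym (cong (_* _) (χ-∉ P∉m)))
        joined-to-P : ∀ Q → I Q ℓ * ∑[ m < #lines ] (I P m * I Q m) ≡ I Q ℓ
        joined-to-P Q with Q ∈? line ℓ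
        ... | yes Q∈ℓ = trans (cong (I Q ℓ *_) (∑-lines-through λ { refl → P∉ℓ Q∈ℓ })) (*-identityʳ _)
        ... | no  Q∉ℓ = trans (cong (_* _) (χ-∉ Q∉ℓ)) (sym (χ-∉ Q∉ℓ))

      weight : (Point → ℤ) → Line → ℤ
      weight w ℓ = ∑[ P < #points ] (w P * I P ℓ)

      -- The lines through P cover every other point once and P itself n + 1 times.
      ∑-pencil-weight : ∀ w P → ∑[ ℓ < #lines ] (I P ℓ * weight w ℓ) ≡ sum w + + n * w P
      ∑-pencil-weight w P = begin
        ∑[ ℓ < #lines ] (I P ℓ * weight w ℓ)          ≡⟨ ∑-assoc-comm (I P) w I ⟩
        ∑[ Q < #points ] (w Q * joining Q)            ≡⟨ sum-cong-≗ (λ Q → split (w Q) (joining Q)) ⟩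
        ∑[ Q < #points ] (w Q + excess Q)             ≡⟨ ∑-distrib-+ w excess ⟩
        sum w + sum excess
          ≡⟨ cong (_+_ (sum w)) (trans (sum-single excess P excess≡0) excess-P) ⟩
        sum w + + n * w P                             ∎
        where
        open ≡-Reasoning
        joining excess : Point → ℤ
        joining Q = ∑[ ℓ < #lines ] (I P ℓ * I Q ℓ)
        excess Q = w Q * (joining Q - 1ℤ)
        split : ∀ w g → w * g ≡ w + w * (g - 1ℤ)
        split = solve-∀
        excess≡0 : ∀ Q → P ≢ Q → excess Q ≡ 0ℤ
        excess≡0 Q P≢Q = trans (cong (λ g → w Q * (g - 1ℤ)) (∑-lines-through P≢Q)) (*-zeroʳ (w Q))
        excess-P : excess P ≡ + n * w P
        excess-P = trans (cong (λ g → w P * (g - 1ℤ))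
          (trans (sum-cong-≗ λ ℓ → 𝟙-idem (lookup (line ℓ) P)) (∑-pencil P))) (*-comm (w P) (+ n))

      ∑-weight : ∀ w → ∑[ ℓ < #lines ] weight w ℓ ≡ sum w * + suc n
      ∑-weight w = begin
        ∑[ ℓ < #lines ] weight w ℓ                      ≡⟨ ∑-comm (λ ℓ P → w P * I P ℓ) ⟩
        ∑[ P < #points ] ∑[ ℓ < #lines ] (w P * I P ℓ)  ≡⟨ sum-cong-≗ (λ P → *-distribˡ-sum (w P) (I P)) ⟨
        ∑[ P < #points ] (w P * sum (I P))              ≡⟨ sum-cong-≗ (λ P → cong (w P *_) (∑-pencil P)) ⟩
        ∑[ P < #points ] (w P * + suc n)                ≡⟨ *-distribʳ-sum (+ suc n) w ⟨
        sum w * + suc n                                 ∎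
        where open ≡-Reasoning

      -- Expanding one factor over the points leaves, at each P, the pencil sum of the other factor.
      ∑-weight² : ∀ w → ∑[ ℓ < #lines ] (weight w ℓ * weight w ℓ) ≡
                        ∑[ P < #points ] (w P * (sum w + + n * w P))
      ∑-weight² w = trans (∑-assoc-comm (weight w) w I) (sum-cong-≗ λ P → cong (w P *_)
        (trans (sum-cong-≗ λ ℓ → *-comm (weight w ℓ) (I P ℓ)) (∑-pencil-weight w P)))

      weight-1 : ∀ ℓ → weight (λ _ → 1ℤ) ℓ ≡ + suc n
      weight-1 ℓ = trans (sum-cong-≗ λ P → *-identityˡ (I P ℓ)) (∑-points-on ℓ)

      -- The pencil identity with all weights 1: n + 1 lines of n + 1 points each cover the plane,
      -- with P counted n extra times.
      #points≡ : + #points ≡ + n * + n + + n + 1ℤ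
      #points≡ = ∙-cancelʳ (+ n) _ _ (begin
        + #points + + n                        ≡⟨ cong₂ _+_ (sum-1 #points) (*-identityʳ (+ n)) ⟨
        sum one + + n * 1ℤ                     ≡⟨ ∑-pencil-weight one P ⟨
        ∑[ ℓ < #lines ] (I P ℓ * weight one ℓ) ≡⟨ sum-cong-≗ (λ ℓ → cong (I P ℓ *_) (weight-1 ℓ)) ⟩
        ∑[ ℓ < #lines ] (I P ℓ * + suc n)      ≡⟨ *-distribʳ-sum (+ suc n) (I P) ⟨
        sum (I P) * + suc n                    ≡⟨ cong (_* + suc n) (∑-pencil P) ⟩
        + suc n * + suc n                      ≡⟨ square (+ n) ⟩
        + n * + n + + n + 1ℤ + + n             ∎)
        where
        open ≡-Reasoning
        open AbelianGroupProperties +-0-abelianGroup using (∙-cancelʳ)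
        P : Point
        P = proj₁ quadrangle 0F
        one : Point → ℤ
        one _ = 1ℤ
        square : ∀ n → (1ℤ + n) * (1ℤ + n) ≡ n * n + n + 1ℤ + n
        square = solve-∀

      -- Counting all incidences by lines and by points shows that there are as many lines as
      -- points.
      #lines≡ : + #lines ≡ + n * + n + + n + 1ℤ
      #lines≡ = trans (*-cancelʳ-≡ (+ #lines) (+ #points) (+ suc n) (begin
        + #lines * + suc n                   ≡⟨ cong (_* + suc n) (sum-1 #lines) ⟨
        sum (λ (_ : Line) → 1ℤ) * + suc n    ≡⟨ *-distribʳ-sum (+ suc n) (λ (_ : Line) → 1ℤ) ⟩
        ∑[ ℓ < #lines ] (1ℤ * + suc n)       ≡⟨ sum-cong-≗ (λ ℓ → trans (*-identityˡ _) (sym (weight-1 ℓ))) ⟩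
        ∑[ ℓ < #lines ] weight (λ _ → 1ℤ) ℓ  ≡⟨ ∑-weight (λ _ → 1ℤ) ⟩
        sum (λ (_ : Point) → 1ℤ) * + suc n   ≡⟨ cong (_* + suc n) (sum-1 #points) ⟩
        + #points * + suc n                  ∎)) #points≡
        where open ≡-Reasoning

  -- Minimal blocking sets attaining the bound

  module Extremal (π : ProjectivePlane) (n t : ℕ) (S : Subset (ProjectivePlane.#points π))
    (order : HasOrder π n) (1≤t : 1 ℕ.≤ t) (t≤n : t ℕ.≤ n)
    (minimal : IsMinimalBlockingSet π t S) (bound : AttainsBound n t ∣ S ∣) where

    open ProjectivePlane π
    open Incidence π
    open Order n order

    m : ℕ
    m = ∣ S ∣

    x : Line → ℕ
    x ℓ = ∣ S ∩ line ℓ ∣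

    instance
      t-nonZero : NonZero t
      t-nonZero = ℕ.>-nonZero 1≤t
      n-nonZero : NonZero n
      n-nonZero = ℕ.>-nonZero (ℕ.≤-trans 1≤t t≤n)

    t≤x : ∀ ℓ → t ℕ.≤ x ℓ
    t≤x = proj₁ (proj₁ minimal)

    weight-S : ∀ ℓ → weight (χ S) ℓ ≡ + x ℓ
    weight-S ℓ = trans (sum-cong-≗ λ P → sym (χ-∩ S (line ℓ) P)) (sum-χ (S ∩ line ℓ))

    -- A tangent, here and below, is a line meeting S in exactly t points.
    τ : Line → ℤ
    τ ℓ = 𝟙 (does (x ℓ ℕ.≟ t))

    #tangents : Point → ℤ
    #tangents P = ∑[ ℓ < #lines ] (τ ℓ * I P ℓ)

    #tangentLines : ℤ
    #tangentLines = ∑[ ℓ < #lines ] τ ℓ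

    τ-tangent : ∀ {ℓ} → x ℓ ≡ t → τ ℓ ≡ 1ℤ
    τ-tangent {ℓ} x≡t = cong 𝟙 (dec-true (x ℓ ℕ.≟ t) x≡t)

    τ-other : ∀ {ℓ} → x ℓ ≢ t → τ ℓ ≡ 0ℤ
    τ-other {ℓ} x≢t = cong 𝟙 (dec-false (x ℓ ℕ.≟ t) x≢t)

    τx≡τt : ∀ ℓ → τ ℓ * + x ℓ ≡ τ ℓ * + t
    τx≡τt ℓ with x ℓ ℕ.≟ t
    ... | yes x≡t = cong (λ y → τ ℓ * + y) x≡t
    ... | no  x≢t = trans (cong (_* + x ℓ) (τ-other x≢t)) (sym (cong (_* + t) (τ-other x≢t)))

    quadratic : + m * + m + + m * + n + + t * + t * (+ n * + n + + n + 1ℤ) ≡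
                + m * (+ t * + n + + 2 * + t) + + t * + n * (+ n * + n + + n + 1ℤ)
    quadratic = begin
      + m * + m + + m * + n + + t * + t * (+ n * + n + + n + 1ℤ)
        ≡⟨ cong₂ _+_ (cong₂ _+_ (pos-* m m) (pos-* m n))
                     (trans (pos-* (t ℕ.* t) L) (cong₂ _*_ (pos-* t t) L≡)) ⟨
      + (m ℕ.* m ℕ.+ m ℕ.* n ℕ.+ t ℕ.* t ℕ.* L)
        ≡⟨ cong +_ (bound⇒quadratic n t m bound) ⟩
      + (m ℕ.* (t ℕ.* n ℕ.+ 2 ℕ.* t) ℕ.+ t ℕ.* n ℕ.* L)
        ≡⟨ cong₂ _+_ (trans (pos-* m _) (cong (+ m *_) (cong₂ _+_ (pos-* t n) (pos-* 2 t))))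
                     (trans (pos-* (t ℕ.* n) L) (cong₂ _*_ (pos-* t n) L≡)) ⟩
      + m * (+ t * + n + + 2 * + t) + + t * + n * (+ n * + n + + n + 1ℤ) ∎
      where
      open ≡-Reasoning
      L : ℕ
      L = n ℕ.* n ℕ.+ n ℕ.+ 1
      L≡ : + L ≡ + n * + n + + n + 1ℤ
      L≡ = cong (λ i → i + + n + 1ℤ) (pos-* n n)

    -- C = n (b + 1): the size m attains the bound exactly when m = t + n b.
    C : ℤ
    C = + m - + t + + n

    -- The value of n x(ℓ) - C on a tangent.
    gap : ℤ
    gap = + n * + t - C

    deviation : Line → ℤ
    deviation ℓ = (1ℤ - τ ℓ) * ((+ n * + x ℓ - C) * (+ n * + x ℓ - C))

    excess : Point → ℤ
    excess P = χ S P * (#tangents P - 1ℤ)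

    -- Moments of the intersection numbers and the vanishing combination

    ∑x : ∑[ ℓ < #lines ] (+ x ℓ) ≡ + m * + suc n
    ∑x = trans (sum-cong-≗ (sym ∘ weight-S)) (trans (∑-weight (χ S)) (cong (_* + suc n) (sum-χ S)))

    ∑x² : ∑[ ℓ < #lines ] (+ x ℓ * + x ℓ) ≡ + m * + m + + n * + m
    ∑x² = begin
      ∑[ ℓ < #lines ] (+ x ℓ * + x ℓ)
        ≡⟨ sum-cong-≗ (λ ℓ → cong₂ _*_ (weight-S ℓ) (weight-S ℓ)) ⟨
      ∑[ ℓ < #lines ] (weight (χ S) ℓ * weight (χ S) ℓ)
        ≡⟨ ∑-weight² (χ S) ⟩
      ∑[ P < #points ] (χ S P * (sum (χ S) + + n * χ S P))
        ≡⟨ sum-cong-≗ (λ P → trans (rearrange (χ S P) (sum (χ S)) (+ n))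
             (cong₂ (λ i j → i * χ S P + + n * j) (sum-χ S) (𝟙-idem (lookup S P)))) ⟩
      ∑[ P < #points ] (+ m * χ S P + + n * χ S P)
        ≡⟨ ∑-linear (+ m) (+ n) (χ S) (χ S) ⟩
      + m * sum (χ S) + + n * sum (χ S)
        ≡⟨ cong (λ i → + m * i + + n * i) (sum-χ S) ⟩
      + m * + m + + n * + m
        ∎
      where
      open ≡-Reasoning
      rearrange : ∀ s m n → s * (m + n * s) ≡ m * s + n * (s * s)
      rearrange = solve-∀

    -- Since n x(ℓ) - C equals `gap` on tangents, each term is (n x(ℓ) - C)² - gap² τ(ℓ). The square
    -- is expanded and summed with the first two moments.
    ∑deviation : sum deviation ≡
      + n * + n * (+ m * + m + + n * + m) + - (+ 2 * + n * C) * (+ m * + suc n) +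
      (C * C * (+ n * + n + + n + 1ℤ) + - (gap * gap) * #tangentLines)
    ∑deviation = begin
      sum deviation                      ≡⟨ sum-cong-≗ expand ⟩
      ∑[ ℓ < #lines ] (var ℓ + rest ℓ)   ≡⟨ ∑-distrib-+ var rest ⟩
      sum var + sum rest
        ≡⟨ cong₂ _+_
             (∑-linear (+ n * + n) (- (+ 2 * + n * C)) (λ ℓ → + x ℓ * + x ℓ) (λ ℓ → + x ℓ))
             (∑-linear (C * C) (- (gap * gap)) (λ _ → 1ℤ) τ) ⟩
      (+ n * + n * ∑[ ℓ < #lines ] (+ x ℓ * + x ℓ) + - (+ 2 * + n * C) * ∑[ ℓ < #lines ] (+ x ℓ)) +
      (C * C * sum (λ (_ : Line) → 1ℤ) + - (gap * gap) * #tangentLines)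
        ≡⟨ cong₂ _+_
             (cong₂ (λ i j → + n * + n * i + - (+ 2 * + n * C) * j) ∑x² ∑x)
             (cong (λ i → C * C * i + - (gap * gap) * #tangentLines) (trans (sum-1 #lines) #lines≡)) ⟩
      _                                  ∎
      where
      open ≡-Reasoning
      var rest : Line → ℤ
      var  ℓ = + n * + n * (+ x ℓ * + x ℓ) + - (+ 2 * + n * C) * + x ℓ
      rest ℓ = C * C * 1ℤ + - (gap * gap) * τ ℓ
      expand : ∀ ℓ → deviation ℓ ≡ var ℓ + rest ℓ
      expand ℓ with x ℓ ℕ.≟ t
      ... | yes x≡t = subst₂ (λ i y → (1ℤ - i) * ((+ n * y - C) * (+ n * y - C)) ≡
                          (+ n * + n * (y * y) + - (+ 2 * + n * C) * y) + (C * C * 1ℤ + - (gap * gap) * i))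
                        (sym (τ-tangent x≡t)) (cong +_ (sym x≡t)) (tangent (+ n) (+ t) C)
        where
        tangent : ∀ n t C → (1ℤ - 1ℤ) * ((n * t - C) * (n * t - C)) ≡
          (n * n * (t * t) + - (+ 2 * n * C) * t) + (C * C * 1ℤ + - ((n * t - C) * (n * t - C)) * 1ℤ)
        tangent = solve-∀
      ... | no  x≢t = subst (λ i → (1ℤ - i) * ((+ n * + x ℓ - C) * (+ n * + x ℓ - C)) ≡
                          var ℓ + (C * C * 1ℤ + - (gap * gap) * i))
                        (sym (τ-other x≢t)) (other (+ n) (+ x ℓ) C gap)
        where
        other : ∀ n x C g → (1ℤ - 0ℤ) * ((n * x - C) * (n * x - C)) ≡
          (n * n * (x * x) + - (+ 2 * n * C) * x) + (C * C * 1ℤ + - (g * g) * 0ℤ)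
        other = solve-∀

    -- Each tangent contains t points of S, so the pairs of a point of S and a tangent through it
    -- number t times the tangents.
    ∑excess : sum excess ≡ + t * #tangentLines - + m
    ∑excess = begin
      sum excess
        ≡⟨ sum-cong-≗ (λ P → expand (χ S P) (#tangents P)) ⟩
      ∑[ P < #points ] (1ℤ * (χ S P * #tangents P) + - 1ℤ * χ S P)
        ≡⟨ ∑-linear 1ℤ (- 1ℤ) (λ P → χ S P * #tangents P) (χ S) ⟩
      1ℤ * ∑[ P < #points ] (χ S P * #tangents P) + - 1ℤ * sum (χ S)
        ≡⟨ cong₂ (λ i j → 1ℤ * i + - 1ℤ * j) flags (sum-χ S) ⟩
      1ℤ * (#tangentLines * + t) + - 1ℤ * + m                  ≡⟨ collect #tangentLines (+ t) (+ m) ⟩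
      + t * #tangentLines - + m                                ∎
      where
      open ≡-Reasoning
      expand : ∀ s T → s * (T - 1ℤ) ≡ 1ℤ * (s * T) + - 1ℤ * s
      expand = solve-∀
      collect : ∀ k t m → 1ℤ * (k * t) + - 1ℤ * m ≡ t * k - m
      collect = solve-∀
      flags : ∑[ P < #points ] (χ S P * #tangents P) ≡ #tangentLines * + t
      flags = begin
        ∑[ P < #points ] (χ S P * #tangents P)  ≡⟨ ∑-assoc-comm τ (χ S) I ⟨
        ∑[ ℓ < #lines ] (τ ℓ * weight (χ S) ℓ)  ≡⟨ sum-cong-≗ (λ ℓ → trans (cong (τ ℓ *_) (weight-S ℓ)) (τx≡τt ℓ)) ⟩
        ∑[ ℓ < #lines ] (τ ℓ * + t)             ≡⟨ *-distribʳ-sum (+ t) τ ⟨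
        #tangentLines * + t                     ∎

    -- Minimality supplies a tangent through every point of S; off S the term is 0.
    excess-nonNeg : ∀ P → 0ℤ ≤ excess P
    excess-nonNeg P with P ∈? S
    ... | no  P∉S = ≤-reflexive (sym (cong (_* (#tangents P - 1ℤ)) (χ-∉ P∉S)))
    ... | yes P∈S = *-nonNeg (𝟙-nonNeg (lookup S P)) (i≤j⇒0≤j-i 1≤#tangents)
      where
      1≤#tangents : 1ℤ ≤ #tangents P
      1≤#tangents with ℓ , P∈ℓ , x≡t ← proj₂ minimal P P∈S =
        ≤-trans (≤-reflexive (sym (cong₂ _*_ (τ-tangent x≡t) (χ-∈ P∈ℓ))))
                (term≤sum (λ ℓ → *-nonNeg (𝟙-nonNeg (does (x ℓ ℕ.≟ t))) (𝟙-nonNeg (lookup (line ℓ) P))) ℓ)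

    deviation-nonNeg : ∀ ℓ → 0ℤ ≤ deviation ℓ
    deviation-nonNeg ℓ = *-nonNeg 0≤1-τ (*-self-nonNeg (+ n * + x ℓ - C))
      where
      0≤1-τ : 0ℤ ≤ 1ℤ - τ ℓ
      0≤1-τ with does (x ℓ ℕ.≟ t)
      ... | true  = ≤-refl
      ... | false = +≤+ ℕ.z≤n

    -- The weights t and gap² are chosen so that the unknown number of tangents cancels. What
    -- remains is -C times the difference of the two sides of `quadratic`.
    balance : + t * sum deviation + gap * gap * sum excess ≡ 0ℤ
    balance = begin
      + t * sum deviation + gap * gap * sum excess
        ≡⟨ cong₂ (λ i j → + t * i + gap * gap * j) ∑deviation ∑excess ⟩
      _                 ≡⟨ identity (+ n) (+ t) (+ m) #tangentLines ⟩
      - C * (lhs - rhs) ≡⟨ cong (- C *_) (i≡j⇒i-j≡0 quadratic) ⟩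
      - C * 0ℤ          ≡⟨ *-zeroʳ (- C) ⟩
      0ℤ                ∎
      where
      open ≡-Reasoning
      lhs rhs : ℤ
      lhs = + m * + m + + m * + n + + t * + t * (+ n * + n + + n + 1ℤ)
      rhs = + m * (+ t * + n + + 2 * + t) + + t * + n * (+ n * + n + + n + 1ℤ)
      identity : ∀ n t m k → let C = m - t + n ; g = n * t - C ; L = n * n + n + 1ℤ in
        t * (n * n * (m * m + n * m) + - (+ 2 * n * C) * (m * (1ℤ + n)) + (C * C * L + - (g * g) * k))
          + g * g * (t * k - m) ≡
        - C * ((m * m + m * n + t * t * L) - (m * (t * n + + 2 * t) + t * n * L))
      identity = solve-∀

    0<m : 0 ℕ.< m
    0<m with ℓ , x≡t ← proj₂ (proj₁ minimal) =
      ℕ.<-≤-trans 1≤t (ℕ.≤-trans (t≤x ℓ) (p⊆q⇒∣p∣≤∣q∣ (p∩q⊆p S (line ℓ))))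

    -- If `gap` were 0, the quadratic equation would reduce to t m + t L (n - t) = 0, where L is the
    -- number of points. As t ≤ n, both terms are nonnegative, while t m is positive.
    gap≢0 : gap ≢ 0ℤ
    gap≢0 gap≡0 = ℕ.≢-nonZero⁻¹ (t ℕ.* m) {{ℕ.m*n≢0 t m {{t-nonZero}} {{ℕ.>-nonZero 0<m}}}}
      (+-injective (trans (pos-* t m) (proj₁ (+-nonNeg-≡0
        (*-nonNeg {+ t} {+ m} (+≤+ ℕ.z≤n) (+≤+ ℕ.z≤n))
        (*-nonNeg {+ t * + #points} (*-nonNeg {+ t} {+ #points} (+≤+ ℕ.z≤n) (+≤+ ℕ.z≤n)) (i≤j⇒0≤j-i (+≤+ t≤n)))
        vanishes))))
      where
      identity : ∀ n t m L → t * m + t * L * (n - t) ≡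
        - (m * (n * t - (m - t + n)) +
          ((m * m + m * n + t * t * L) - (m * (t * n + + 2 * t) + t * n * L)))
      identity = solve-∀
      vanishes : + t * + m + + t * + #points * (+ n - + t) ≡ 0ℤ
      vanishes = trans (identity (+ n) (+ t) (+ m) (+ #points)) (cong -_ (cong₂ _+_
        (trans (cong (+ m *_) gap≡0) (*-zeroʳ (+ m)))
        (trans (cong (λ L → (+ m * + m + + m * + n + + t * + t * L) -
                            (+ m * (+ t * + n + + 2 * + t) + + t * + n * L)) #points≡)
               (i≡j⇒i-j≡0 quadratic))))

    -- Consequences of the vanishing sums

    deviation≡0×gap²excess≡0 : + t * sum deviation ≡ 0ℤ × gap * gap * sum excess ≡ 0ℤ
    deviation≡0×gap²excess≡0 = +-nonNeg-≡0
      (*-nonNeg {+ t} (+≤+ ℕ.z≤n) (sum-nonNeg deviation-nonNeg))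
      (*-nonNeg (*-self-nonNeg gap) (sum-nonNeg excess-nonNeg))
      balance

    other-line : ∀ ℓ → x ℓ ≢ t → + n * + x ℓ ≡ C
    other-line ℓ x≢t = i-j≡0⇒i≡j (+ n * + x ℓ) C ([ id , id ]′ (i*j≡0⇒i≡0∨j≡0 δ δδ≡0))
      where
      δ : ℤ
      δ = + n * + x ℓ - C
      ∑≡0 : sum deviation ≡ 0ℤ
      ∑≡0 = *-≡0ʳ (+ t) (ℕ.≢-nonZero⁻¹ t ∘ +-injective) (proj₁ deviation≡0×gap²excess≡0)
      δδ≡0 : δ * δ ≡ 0ℤ
      δδ≡0 = trans (sym (trans (cong (λ i → (1ℤ - i) * (δ * δ)) (τ-other x≢t)) (*-identityˡ (δ * δ))))
                   (sum-nonNeg-≡0 deviation-nonNeg ∑≡0 ℓ)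

    one-tangent : ∀ {P} → P ∈ S → #tangents P ≡ 1ℤ
    one-tangent {P} P∈S = i-j≡0⇒i≡j (#tangents P) 1ℤ
      (trans (sym (trans (cong (_* (#tangents P - 1ℤ)) (χ-∈ P∈S)) (*-identityˡ _)))
             (sum-nonNeg-≡0 excess-nonNeg ∑≡0 P))
      where
      ∑≡0 : sum excess ≡ 0ℤ
      ∑≡0 = *-≡0ʳ gap gap≢0 (*-≡0ʳ gap gap≢0
        (trans (sym (*-assoc gap gap (sum excess))) (proj₂ deviation≡0×gap²excess≡0)))

    point-in-S : ∃ λ P → P ∈ S
    point-in-S with nonempty? S
    ... | yes P∈S = P∈S
    ... | no  S≡∅ = contradiction (sym (trans (cong ∣_∣ (Empty-unique S≡∅)) (∣⊥∣≡0 #points)))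
                                  (ℕ.<⇒≢ 0<m)

    -- If S were the whole plane, a tangent would meet it in n + 1 > t points.
    point-outside-S : ∃ λ P → P ∉ S
    point-outside-S = Fin.¬∀⟶∃¬ #points (_∈ S) (_∈? S) λ all∈S → ℕ.<⇒≱ (ℕ.s≤s t≤n) (begin
      suc n                  ≡⟨ order ℓ ⟨
      ∣ line ℓ ∣             ≤⟨ p⊆q⇒∣p∣≤∣q∣ (λ {P} P∈ℓ → x∈p∩q⁺ (all∈S P , P∈ℓ)) ⟩
      x ℓ                    ≡⟨ proj₂ (proj₂ (proj₁ minimal)) ⟩
      t                      ∎)
      where
      open ℕ.≤-Reasoning
      ℓ : Line
      ℓ = proj₁ (proj₂ (proj₁ minimal))

    -- If all lines were tangents, a point of S would lie on n + 1 of them instead of one.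
    secant-line : ∃ λ ℓ → x ℓ ≢ t
    secant-line with P , P∈S ← point-in-S =
      Fin.¬∀⟶∃¬ #lines (λ ℓ → x ℓ ≡ t) (λ ℓ → x ℓ ℕ.≟ t) λ all≡t →
        ℕ.≢-nonZero⁻¹ n (ℕ.suc-injective (+-injective (trans (sym (trans
          (sum-cong-≗ λ ℓ → trans (cong (_* I P ℓ) (τ-tangent (all≡t ℓ))) (*-identityˡ (I P ℓ)))
          (∑-pencil P))) (one-tangent P∈S))))

    #points≡ℕ : #points ≡ n ℕ.* n ℕ.+ n ℕ.+ 1
    #points≡ℕ = +-injective (trans #points≡ (cong (λ i → i + + n + 1ℤ) (sym (pos-* n n))))

    -- The two intersection numbers and their equations

    module Secant (ℓ₀ : Line) (x₀≢t : x ℓ₀ ≢ t) where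

      -- The difference of the two intersection numbers: d + t is b + 1 in the notation of the
      -- bound.
      d : ℕ
      d = x ℓ₀ ℕ.∸ t
      d+t≡x₀ : d ℕ.+ t ≡ x ℓ₀
      d+t≡x₀ = ℕ.m∸n+n≡m (t≤x ℓ₀)
      instance
        d-nonZero : NonZero d
        d-nonZero = ℕ.≢-nonZero λ d≡0 → x₀≢t (trans (sym d+t≡x₀) (cong (ℕ._+ t) d≡0))
      spectrum : ∀ ℓ → x ℓ ≡ t ⊎ x ℓ ≡ d ℕ.+ t
      spectrum ℓ with x ℓ ℕ.≟ t
      ... | yes x≡t = inj₁ x≡t
      ... | no  x≢t = inj₂ (trans (+-injective (*-cancelˡ-≡ (+ n) (+ x ℓ) (+ x ℓ₀)
                        (trans (other-line ℓ x≢t) (sym (other-line ℓ₀ x₀≢t))))) (sym d+t≡x₀))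
      size : m ℕ.+ n ≡ t ℕ.+ n ℕ.* (d ℕ.+ t)
      size = +-injective (begin
        + m + + n                       ≡⟨ add-back (+ m) (+ n) (+ t) ⟩
        + t + C                         ≡⟨ cong (_+_ (+ t)) (other-line ℓ₀ x₀≢t) ⟨
        + t + + n * + x ℓ₀              ≡⟨ cong (λ y → + t + + n * + y) d+t≡x₀ ⟨
        + t + + n * + (d ℕ.+ t)         ≡⟨ cong (_+_ (+ t)) (pos-* n (d ℕ.+ t)) ⟨
        + (t ℕ.+ n ℕ.* (d ℕ.+ t))       ∎)
        where
        open ≡-Reasoning
        add-back : ∀ m n t → m + n ≡ t + (m - t + n)
        add-back = solve-∀

      sizeℤ : + m + + n ≡ + t + + n * (+ d + + t)
      sizeℤ = trans (cong +_ size) (cong (_+_ (+ t)) (pos-* n (d ℕ.+ t)))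

      -- This is d (d - 1) = t (n + 1 - d - t) without subtraction. Substituting m = t + n (d + t) -
      -- n into `quadratic` yields n² times the difference of its sides, and n ≠ 0.
      parameter-equation : d ℕ.* d ℕ.+ t ℕ.* (d ℕ.+ t) ≡ d ℕ.+ t ℕ.* suc n
      parameter-equation = +-injective (begin
        + (d ℕ.* d ℕ.+ t ℕ.* (d ℕ.+ t))     ≡⟨ cong₂ _+_ (pos-* d d) (pos-* t (d ℕ.+ t)) ⟩
        + d * + d + + t * (+ d + + t)       ≡⟨ i-j≡0⇒i≡j _ _ (*-≡0ʳ (+ n) n≢0 (*-≡0ʳ (+ n) n≢0 vanishes)) ⟩
        + d + + t * + suc n                 ≡⟨ cong (_+_ (+ d)) (pos-* t (suc n)) ⟨
        + (d ℕ.+ t ℕ.* suc n)               ∎)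
        where
        open ≡-Reasoning
        n≢0 : + n ≢ 0ℤ
        n≢0 = ℕ.≢-nonZero⁻¹ n ∘ +-injective
        M : ℤ
        M = + t + + n * (+ d + + t) - + n
        m≡M : + m ≡ M
        m≡M = trans (sym (cancel (+ m) (+ n))) (cong (_- + n) sizeℤ)
          where
          cancel : ∀ m n → m + n - n ≡ m
          cancel = solve-∀
        identity : ∀ n t d → let m = t + n * (d + t) - n ; L = n * n + n + 1ℤ in
          n * (n * (d * d + t * (d + t) - (d + t * (1ℤ + n)))) ≡
          (m * m + m * n + t * t * L) - (m * (t * n + + 2 * t) + t * n * L)
        identity = solve-∀
        vanishes : + n * (+ n * (+ d * + d + + t * (+ d + + t) - (+ d + + t * + suc n))) ≡ 0ℤ
        vanishes = trans (identity (+ n) (+ t) (+ d)) (i≡j⇒i-j≡0 (subst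
          (λ m → m * m + m * + n + + t * + t * (+ n * + n + + n + 1ℤ) ≡
                 m * (+ t * + n + + 2 * + t) + + t * + n * (+ n * + n + + n + 1ℤ))
          m≡M quadratic))

      -- Let T be the number of tangents through P. Counting S along the pencil of P gives m = (d +
      -- t)(n + 1) - d T; comparison with `size` leaves n = (T - 1) d. The absolute value makes the
      -- quotient a natural number.
      d∣n : ∀ {P} → P ∉ S → d ℕ.∣ n
      d∣n {P} P∉S = ℕ.divides ℤ.∣ #tangents P - 1ℤ ∣
        (trans (cong ℤ.∣_∣ n≡) (abs-* (#tangents P - 1ℤ) (+ d)))
        where
        -- One formula for both intersection numbers, x(ℓ) = d + t - d τ(ℓ), restricted to lines
        -- through P.
        x≡ : ∀ ℓ → I P ℓ * weight (χ S) ℓ ≡ (+ d + + t) * I P ℓ + - + d * (τ ℓ * I P ℓ)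
        x≡ ℓ with spectrum ℓ
        ... | inj₁ x≡t   = trans (cong (I P ℓ *_) (trans (weight-S ℓ) (cong +_ x≡t)))
          (trans (collect (I P ℓ) (+ d) (+ t))
                 (cong (λ i → (+ d + + t) * I P ℓ + - + d * (i * I P ℓ)) (sym (τ-tangent x≡t))))
          where
          collect : ∀ i d t → i * t ≡ (d + t) * i + - d * (1ℤ * i)
          collect = solve-∀
        ... | inj₂ x≡d+t = trans (cong (I P ℓ *_) (trans (weight-S ℓ) (cong +_ x≡d+t)))
          (trans (collect (I P ℓ) (+ d) (+ t))
                 (cong (λ i → (+ d + + t) * I P ℓ + - + d * (i * I P ℓ)) (sym (τ-other x≢t))))
          where
          x≢t : x ℓ ≢ t
          x≢t x≡t = ℕ.≢-nonZero⁻¹ d (ℕ.+-cancelʳ-≡ t d 0 (trans (sym x≡d+t) x≡t))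
          collect : ∀ i d t → i * (d + t) ≡ (d + t) * i + - d * (0ℤ * i)
          collect = solve-∀
        through-P : + m ≡ (+ d + + t) * + suc n + - + d * #tangents P
        through-P = begin
          + m                                             ≡⟨ +-identityʳ (+ m) ⟨
          + m + 0ℤ
            ≡⟨ cong₂ _+_ (sum-χ S) (trans (cong (+ n *_) (χ-∉ P∉S)) (*-zeroʳ (+ n))) ⟨
          sum (χ S) + + n * χ S P                         ≡⟨ ∑-pencil-weight (χ S) P ⟨
          ∑[ ℓ < #lines ] (I P ℓ * weight (χ S) ℓ)        ≡⟨ sum-cong-≗ x≡ ⟩
          ∑[ ℓ < #lines ] ((+ d + + t) * I P ℓ + - + d * (τ ℓ * I P ℓ))
            ≡⟨ ∑-linear (+ d + + t) (- + d) (I P) (λ ℓ → τ ℓ * I P ℓ) ⟩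
          (+ d + + t) * sum (I P) + - + d * #tangents P
            ≡⟨ cong (λ i → (+ d + + t) * i + - + d * #tangents P) (∑-pencil P) ⟩
          (+ d + + t) * + suc n + - + d * #tangents P     ∎
          where open ≡-Reasoning
        n≡ : + n ≡ (#tangents P - 1ℤ) * + d
        n≡ = trans (eliminate (+ m) (+ n)) (trans (cong₂ _-_ sizeℤ through-P)
          (collect (+ n) (+ d) (+ t) (#tangents P)))
          where
          eliminate : ∀ m n → n ≡ m + n - m
          eliminate = solve-∀
          collect : ∀ n d t T → t + n * (d + t) - ((d + t) * (1ℤ + n) + - d * T) ≡ (T - 1ℤ) * d
          collect = solve-∀

      -- The three geometric cases

      equality-case : Solution n d t →
        (∃ λ s → s ℕ.* s ≡ n × t ≡ 1 × IsUnital π n s S) ⊎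
        (∃ λ s → s ℕ.* s ≡ n × t ≡ n ℕ.∸ s × IsBaerSubplane π n s (∁ S)) ⊎
        (t ≡ n × ∃ λ P → S ≡ ⊤ Subset.- P)
      equality-case (inj₁ (dd≡n , t≡1)) = inj₁ (d , dd≡n , t≡1 , unital-size , unital-lines)
        where
        unital-size : m ≡ n ℕ.* d ℕ.+ 1
        unital-size = ℕ.+-cancelʳ-≡ n _ _
          (trans size (trans (cong (λ t → t ℕ.+ n ℕ.* (d ℕ.+ t)) t≡1) (expand n d)))
          where
          expand : ∀ n d → 1 ℕ.+ n ℕ.* (d ℕ.+ 1) ≡ n ℕ.* d ℕ.+ 1 ℕ.+ n
          expand = ℕ-Solver.solve-∀
        unital-lines : ∀ ℓ → x ℓ ≡ 1 ⊎ x ℓ ≡ d ℕ.+ 1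
        unital-lines ℓ = map (λ x≡t → trans x≡t t≡1)
                             (λ x≡d+t → trans x≡d+t (cong (d ℕ.+_) t≡1))
                             (spectrum ℓ)
      -- Here d = √n. From d + t = n and `size`, m = n² - d, so the complement has n² + n + 1 - m =
      -- n + d + 1 points.
      equality-case (inj₂ (inj₁ (dd≡n , d+t≡n))) = inj₂ (inj₁ (d , dd≡n , t≡n∸d , baer-size , baer-lines))
        where
        t≡n∸d : t ≡ n ℕ.∸ d
        t≡n∸d = sym (trans (cong (ℕ._∸ d) (sym d+t≡n)) (ℕ.m+n∸m≡n d t))
        ∁-size : ∣ ∁ S ∣ ℕ.+ m ≡ n ℕ.* n ℕ.+ n ℕ.+ 1
        ∁-size = trans (cong (ℕ._+ m) (∣∁p∣≡n∸∣p∣ S)) (trans (ℕ.m∸n+n≡m (∣p∣≤n S)) #points≡ℕ)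
        m+d≡nn : m ℕ.+ d ≡ n ℕ.* n
        m+d≡nn = ℕ.+-cancelʳ-≡ n _ _ (begin
          m ℕ.+ d ℕ.+ n                    ≡⟨ swap-+ m d n ⟩
          m ℕ.+ n ℕ.+ d                    ≡⟨ cong (ℕ._+ d) (trans size (cong (λ i → t ℕ.+ n ℕ.* i) d+t≡n)) ⟩
          t ℕ.+ n ℕ.* n ℕ.+ d              ≡⟨ rotate t (n ℕ.* n) d ⟩
          n ℕ.* n ℕ.+ (d ℕ.+ t)            ≡⟨ cong (n ℕ.* n ℕ.+_) d+t≡n ⟩
          n ℕ.* n ℕ.+ n                    ∎)
          where
          open ≡-Reasoning
          swap-+ : ∀ m d n → m ℕ.+ d ℕ.+ n ≡ m ℕ.+ n ℕ.+ d
          swap-+ = ℕ-Solver.solve-∀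
          rotate : ∀ t k d → t ℕ.+ k ℕ.+ d ≡ k ℕ.+ (d ℕ.+ t)
          rotate = ℕ-Solver.solve-∀
        baer-size : ∣ ∁ S ∣ ≡ n ℕ.+ d ℕ.+ 1
        baer-size = ℕ.+-cancelʳ-≡ m _ _ (trans ∁-size
          (trans (cong (λ i → i ℕ.+ n ℕ.+ 1) (sym m+d≡nn)) (rearrange m d n)))
          where
          rearrange : ∀ m d n → m ℕ.+ d ℕ.+ n ℕ.+ 1 ≡ n ℕ.+ d ℕ.+ 1 ℕ.+ m
          rearrange = ℕ-Solver.solve-∀
        baer-lines : ∀ ℓ → ∣ ∁ S ∩ line ℓ ∣ ≡ 1 ⊎ ∣ ∁ S ∩ line ℓ ∣ ≡ d ℕ.+ 1
        -- A line has n + 1 = d + t + 1 points, so tangents of S meet the complement in d + 1 points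
        -- and all other lines in 1: the two alternatives change places.
        baer-lines ℓ = swap (map
          (λ x≡t   → ℕ.+-cancelʳ-≡ (x ℓ) _ _ (trans complement
            (trans (cong suc (sym d+t≡n)) (trans (rearrange d t) (cong (d ℕ.+ 1 ℕ.+_) (sym x≡t))))))
          (λ x≡d+t → ℕ.+-cancelʳ-≡ (x ℓ) _ _ (trans complement (cong suc (sym (trans x≡d+t d+t≡n)))))
          (spectrum ℓ))
          where
          complement : ∣ ∁ S ∩ line ℓ ∣ ℕ.+ x ℓ ≡ suc n
          complement = trans (∣∁p∩q∣+∣p∩q∣≡∣q∣ S (line ℓ)) (order ℓ)
          rearrange : ∀ d t → suc (d ℕ.+ t) ≡ d ℕ.+ 1 ℕ.+ t
          rearrange = ℕ-Solver.solve-∀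
      -- With d = 1 and t = n, `size` gives m = n² + n, one less than the number of points.
      equality-case (inj₂ (inj₂ (d≡1 , t≡n))) = inj₂ (inj₂ (t≡n , 1+∣p∣≡n⇒p≡⊤-x S (begin
        suc m                     ≡⟨ cong suc (ℕ.+-cancelʳ-≡ n m (n ℕ.* n ℕ.+ n) m+n≡) ⟩
        suc (n ℕ.* n ℕ.+ n)       ≡⟨ ℕ.+-comm 1 (n ℕ.* n ℕ.+ n) ⟩
        n ℕ.* n ℕ.+ n ℕ.+ 1       ≡⟨ #points≡ℕ ⟨
        #points                   ∎)))
        where
        open ≡-Reasoning
        m+n≡ : m ℕ.+ n ≡ n ℕ.* n ℕ.+ n ℕ.+ n
        m+n≡ = trans size (trans (cong₂ (λ d t → t ℕ.+ n ℕ.* (d ℕ.+ t)) d≡1 t≡n) (expand n))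
          where
          expand : ∀ n → n ℕ.+ n ℕ.* (1 ℕ.+ n) ≡ n ℕ.* n ℕ.+ n ℕ.+ n
          expand = ℕ-Solver.solve-∀

-- Classification of equality in prime-power order

open import Data.Nat.Base using (ℕ; _≤_; _*_; _∸_)
open import Data.Fin.Subset using (Subset; ∣_∣; ∁; ⊤; _-_)
open ProjectivePlane using (#points; Point)

mainTheorem1 :
    (π : ProjectivePlane) (q t : ℕ) (S : Subset (#points π)) →
    HasOrder π q → IsPrimePower q →
    1 ≤ t → t ≤ q →
    IsMinimalBlockingSet π t S →
    AttainsBound q t ∣ S ∣ →
    (∃ λ s → s * s ≡ q × t ≡ 1 × IsUnital π q s S) ⊎
    (∃ λ s → s * s ≡ q × t ≡ q ∸ s × IsBaerSubplane π q s (∁ S)) ⊎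
    (t ≡ q × ∃ λ (P : Point π) → S ≡ ⊤ - P)
mainTheorem1 π q t S order q-primePower 1≤t t≤q minimal bound =
  equality-case (solution d t q-primePower (d∣n (proj₂ point-outside-S)) parameter-equation)
  where
  open Parameters using (solution)
  open Counting.Extremal π q t S order 1≤t t≤q minimal bound
  open Secant (proj₁ secant-line) (proj₂ secant-line)
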